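{- For every integer $n\ge 8$ with $n\equiv 0 \pmod 8$, there exists a $2$-connected cubic $n$-vertex graph $G$ with $\mathrm{minexc}(G)=n/4$.
   Context: All graphs are finite and simple. A graph is cubic if every vertex has degree exactly three. A graph is $2$-connected if it has at least three vertices and is connected and remains connected after the removal of any single vertex. A graph is Eulerian if all its vertices have even degree (it need not be connected). A subgraph of $G$ is spanning if it contains all vertices of $G$ (possibly some as isolated vertices). For a graph $F$, let $c(F)$ be the number of its components with at least two vertices and $i(F)$ the number of its isolated vertices, and let $\mathrm{exc}(F)=2c(F)+i(F)$. For a graph $G$ with maximum degree at most three, $\mathrm{minexc}(G)$ is the minimum of $\mathrm{exc}(F)$ over all spanning Eulerian subgraphs $F$ of $G$. -}

module Defs where

open import Data.Bool.Properties using () renaming (_≟_ to _≟ᵇ_)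
open import Data.Fin using (Fin; _≟_)
open import Data.Fin.Subset using (Subset; _∈_; _∉_; _⊆_; ∣_∣)
open import Data.Fin.Subset.Properties using (_∈?_)
open import Data.List using (List; []; _∷_; allFin; deduplicate; filter; length; map)
open import Data.List.Membership.Propositional using () renaming (_∈_ to _∈ˡ_)
open import Data.List.Membership.Propositional.Properties using (∈-allFin)
open import Data.List.Relation.Unary.Any using (here; there)
open import Data.Nat using (ℕ; _+_; _*_; _≤_; _≤?_) renaming (_≟_ to _≟ⁿ_)
open import Data.Nat.Divisibility using (_∣_)
open import Data.Product using (_×_; _,_; ∃-syntax)
open import Data.Sum using (_⊎_; inj₁; inj₂)
open import Data.Vec using (tabulate)
open import Data.Vec.Properties using (≡-dec)
open import Level using (0ℓ)
open import Relation.Binary using (Decidable; Rel)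
open import Relation.Binary.Construct.Closure.ReflexiveTransitive using (Star; ε; _◅_; _◅◅_)
open import Relation.Binary.PropositionalEquality using (_≡_; _≢_; refl)
open import Relation.Nullary using (does)
open import Relation.Nullary.Decidable using (map′; _×-dec_; _⊎-dec_)

-- Reachability over a finite type is decidable (Warshall's algorithm):
-- Via ks u v holds when v can be reached from u with every intermediate
-- vertex in ks.

module Reachability {n : ℕ} {R : Rel (Fin n) 0ℓ} (R? : Decidable R) where

  Via : List (Fin n) → Rel (Fin n) 0ℓ
  Via []       u v = u ≡ v ⊎ R u v
  Via (k ∷ ks) u v = Via ks u v ⊎ (Via ks u k × Via ks k v)

  via? : ∀ ks → Decidable (Via ks)
  via? []       u v = (u ≟ v) ⊎-dec R? u v
  via? (k ∷ ks) u v = via? ks u v ⊎-dec (via? ks u k ×-dec via? ks k v)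

  via⇒star : ∀ ks {u v} → Via ks u v → Star R u v
  via⇒star []       (inj₁ refl)    = ε
  via⇒star []       (inj₂ r)       = r ◅ ε
  via⇒star (k ∷ ks) (inj₁ p)       = via⇒star ks p
  via⇒star (k ∷ ks) (inj₂ (p , q)) = via⇒star ks p ◅◅ via⇒star ks q

  via-refl : ∀ ks {u} → Via ks u u
  via-refl []       = inj₁ refl
  via-refl (k ∷ ks) = inj₁ (via-refl ks)

  via-step : ∀ ks {u v} → R u v → Via ks u v
  via-step []       r = inj₂ r
  via-step (k ∷ ks) r = inj₁ (via-step ks r)

  via-trans : ∀ ks {u w v} → w ∈ˡ ks → Via ks u w → Via ks w v → Via ks u v
  via-trans (k ∷ ks) (here refl) p q = inj₂ (toHead p , fromHead q)
    where
    toHead : ∀ {u} → Via (k ∷ ks) u k → Via ks u k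
    toHead (inj₁ a)       = a
    toHead (inj₂ (a , _)) = a
    fromHead : ∀ {v} → Via (k ∷ ks) k v → Via ks k v
    fromHead (inj₁ b)       = b
    fromHead (inj₂ (_ , b)) = b
  via-trans (k ∷ ks) (there w∈) (inj₁ a)       (inj₁ b)       = inj₁ (via-trans ks w∈ a b)
  via-trans (k ∷ ks) (there w∈) (inj₁ a)       (inj₂ (b , c)) = inj₂ (via-trans ks w∈ a b , c)
  via-trans (k ∷ ks) (there w∈) (inj₂ (a , b)) (inj₁ c)       = inj₂ (a , via-trans ks w∈ b c)
  via-trans (k ∷ ks) (there w∈) (inj₂ (a , _)) (inj₂ (_ , d)) = inj₂ (a , d)

  star⇒via : ∀ {u v} → Star R u v → Via (allFin n) u v
  star⇒via ε        = via-refl (allFin n)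
  star⇒via (r ◅ rs) =
    via-trans (allFin n) (∈-allFin _) (via-step (allFin n) r) (star⇒via rs)

  star? : Decidable (Star R)
  star? u v = map′ (via⇒star (allFin n)) star⇒via (via? (allFin n) u v)

record Graph (n : ℕ) : Set where
  field
    nbhd   : Fin n → Subset n
    sym    : ∀ {u v} → v ∈ nbhd u → u ∈ nbhd v
    irrefl : ∀ {v} → v ∉ nbhd v

open Graph public using (nbhd)

module _ {n : ℕ} (G : Graph n) where

  Adj : Rel (Fin n) 0ℓ
  Adj u v = v ∈ nbhd G u

  adj? : Decidable Adj
  adj? u v = v ∈? nbhd G u

  degree : Fin n → ℕ
  degree v = ∣ nbhd G v ∣

  Cubic : Set
  Cubic = ∀ v → degree v ≡ 3

  Eulerian : Set
  Eulerian = ∀ v → 2 ∣ degree v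

  Reachable : Rel (Fin n) 0ℓ
  Reachable = Star Adj

  reachable? : Decidable Reachable
  reachable? = Reachability.star? adj?

  Connected : Set
  Connected = ∀ u v → Reachable u v

  AdjWithout : Fin n → Rel (Fin n) 0ℓ
  AdjWithout w u v = u ≢ w × v ≢ w × Adj u v

  ConnectedWithout : Fin n → Set
  ConnectedWithout w = ∀ u v → u ≢ w → v ≢ w → Star (AdjWithout w) u v

  TwoConnected : Set
  TwoConnected = 3 ≤ n × Connected × (∀ w → ConnectedWithout w)

  component : Fin n → Subset n
  component v = tabulate (λ u → does (reachable? v u))


  components : List (Subset n)
  components = deduplicate (≡-dec _≟ᵇ_) (map component (allFin n))

  nontrivialComponents : ℕ
  nontrivialComponents = length (filter (λ S → 2 ≤? ∣ S ∣) components)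

  isolatedVertices : ℕ
  isolatedVertices = length (filter (λ v → degree v ≟ⁿ 0) (allFin n))

  exc : ℕ
  exc = 2 * nontrivialComponents + isolatedVertices

-- A spanning subgraph has the same vertex set Fin n, so only edges vary.
SpanningSubgraph : ∀ {n} → Graph n → Graph n → Set
SpanningSubgraph F G = ∀ v → nbhd F v ⊆ nbhd G v

-- MinExc G k says minexc(G) = k: the value k is attained and is a lower bound.
MinExc : ∀ {n} → Graph n → ℕ → Set
MinExc {n} G k =
  (∃[ F ] SpanningSubgraph F G × Eulerian F × exc F ≡ k) ×
  (∀ (F : Graph n) → SpanningSubgraph F G → Eulerian F → k ≤ exc F)

{-# OPTIONS --safe #-}
module Submission where

-- The extremal graph on 8 (j + 1) vertices is a ladder with two rails.  Both ends are closed by a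
-- diamond (K₄ minus an edge, attached by its two vertices of degree 2), and the j blocks in between
-- consist of a rung P₀P₁ that is an edge, followed by a rung Q₀Q₁ that is a diamond.  In a spanning
-- Eulerian subgraph F, parity shows, block by block from the left end, that the edges of
-- the two rails at the same place are both present or both absent, and likewise for the two edges at
-- a diamond.  Each Q has degree 3 in the ladder, so F misses one of its edges together with the
-- partner of that edge: this separates the diamond of the block, or everything up to the rung P₀P₁,
-- or everything up to the rung Q₀Q₁.  In each case two vertices of the block have components not
-- extending beyond the block, so either one of these is nontrivial or both vertices are isolated,
-- and the block contributes 2 to exc(F).  The right end contributes another 2.  A 2-factor with
-- j + 1 cycles attains this bound.

open import Defs
open import Data.Bool using (Bool; true; false; _xor_)
open import Data.Bool.Properties using (¬-not) renaming (_≟_ to _≟ᵇ_)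
open import Data.Fin using (Fin; zero; suc; toℕ; fromℕ; fromℕ<; inject₁; opposite; _≟_)
open import Data.Fin.Induction using (<-weakInduction)
open import Data.Fin.Patterns using (0F; 1F)
open import Data.Fin.Properties
  using (injective⇒≤; toℕ-inject₁; toℕ-fromℕ; toℕ-fromℕ<; toℕ<n; toℕ-injective; +↔⊎; *↔×)
open import Data.Fin.Relation.Unary.Top using (View; view; ‵fromℕ; ‵inject₁; view-fromℕ; view-inject₁)
open import Data.Fin.Subset using (Subset; inside; outside; _∈_; _∉_; ∣_∣)
open import Data.Fin.Subset.Properties using (_∈?_; Empty-unique; ∣⊥∣≡0; ⊆-antisym; nonempty?)
open import Data.List using (List; []; _∷_; length; map; allFin; lookup)
open import Data.List.Properties
  using (map-cong-local; map-∘; length-map; length-tabulate; length-filter; filter-none)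
open import Data.List.Membership.DecPropositional as DecMembership using ()
open import Data.List.Membership.Propositional using () renaming (_∈_ to _∈ˡ_; _∉_ to _∉ˡ_)
open import Data.List.Membership.Propositional.Properties
  using (∈-allFin; ∈-lookup; ∈-map⁺; ∈-map⁻; ∈-filter⁺; ∈-deduplicate⁺; ∈-deduplicate⁻)
open import Data.List.Relation.Unary.All as All using (All; []; _∷_)
open import Data.List.Relation.Unary.All.Properties using () renaming (map⁺ to All-map⁺)
open import Data.List.Relation.Unary.AllPairs using ([]; _∷_)
open import Data.List.Relation.Unary.Any as Any using (here; there)
open import Data.List.Relation.Unary.Any.Properties using (lookup-index)
open import Data.List.Relation.Unary.Unique.DecPropositional.Properties using (deduplicate-!)
open import Data.List.Relation.Unary.Unique.Propositional using (Unique)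
import Data.List.Relation.Unary.Unique.Propositional.Properties as Unique
open import Data.Nat
  using (ℕ; zero; suc; _+_; _*_; _∸_; _⊔_; _≤_; _<_; z≤n; s≤s; s≤s⁻¹; _≤?_; _/_) renaming (_≟_ to _≟ⁿ_)
open import Data.Nat.Divisibility using (_∣_; divides; _∣?_)
open import Data.Nat.DivMod using (m*n/n≡m)
open import Data.Nat.Induction using (<-wellFounded)
open import Data.Nat.ListAction using (sum)
open import Data.Nat.Properties hiding (_≟_)
open import Data.Product using (_×_; _,_; ∃-syntax; Σ-syntax; proj₁; proj₂)
open import Data.Product.Function.NonDependent.Propositional using (_×-↔_)
open import Data.Sum using (_⊎_; inj₁; inj₂)
open import Data.Unit using (⊤; tt)
open import Data.Vec as Vec using (_∷_; tabulate; _[_]≔_)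
open import Data.Vec.Properties
  using (≡-dec; []=⇒lookup; lookup⇒[]=; lookup∘tabulate; lookup∘update; lookup∘update′)
open import Function using (_∘_; case_of_; _↔_; Inverse)
open import Function.Construct.Composition using (_↔-∘_)
open import Function.Construct.Symmetry using (↔-sym)
open import Induction.WellFounded using (Acc; acc)
open import Level using (0ℓ)
open import Relation.Binary using (Rel)
open import Relation.Binary.Construct.Closure.ReflexiveTransitive using (Star; ε; _◅_; _◅◅_; reverse)
open import Relation.Binary.PropositionalEquality
open import Relation.Nullary using (Dec; yes; no; does)
open import Relation.Nullary.Decidable using (dec-true; from-no)
open import Relation.Nullary.Negation using (contradiction)

private
  variable
    n : ℕ

-- Counting

lookup-injective : ∀ {a} {A : Set a} {xs : List A} → Unique xs →
  ∀ {i k} → lookup xs i ≡ lookup xs k → i ≡ k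
lookup-injective {xs = _ ∷ _}  _          {zero}  {zero}  _  = refl
lookup-injective {xs = _ ∷ xs} (x∉ ∷ _)   {zero}  {suc k} eq = contradiction eq (All.lookup x∉ (∈-lookup k))
lookup-injective {xs = _ ∷ xs} (x∉ ∷ _)   {suc i} {zero}  eq = contradiction (sym eq) (All.lookup x∉ (∈-lookup i))
lookup-injective {xs = _ ∷ _}  (_ ∷ uniq) {suc i} {suc k} eq = cong suc (lookup-injective uniq eq)

-- Pigeonhole: sending an index of `xs` to the index of the same element in `ys` is injective.
unique-⊆⇒length≤ : ∀ {a} {A : Set a} {xs ys : List A} → Unique xs →
  (∀ {x} → x ∈ˡ xs → x ∈ˡ ys) → length xs ≤ length ys
unique-⊆⇒length≤ {xs = xs} {ys} uniq xs⊆ys = injective⇒≤ {f = position} position-injective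
  where
  position : Fin (length xs) → Fin (length ys)
  position i = Any.index (xs⊆ys (∈-lookup i))
  lookup-position : ∀ i → lookup xs i ≡ lookup ys (position i)
  lookup-position i = lookup-index (xs⊆ys (∈-lookup i))
  position-injective : ∀ {i k} → position i ≡ position k → i ≡ k
  position-injective {i} {k} eq = lookup-injective uniq
    (trans (lookup-position i) (trans (cong (lookup ys) eq) (sym (lookup-position k))))

bit : Bool → ℕ
bit true  = 1
bit false = 0

∣∣-remove : ∀ (S : Subset n) {x} → x ∈ S → ∣ S ∣ ≡ suc ∣ S [ x ]≔ outside ∣
∣∣-remove (inside  ∷ S) Vec.here        = refl
∣∣-remove (inside  ∷ S) (Vec.there x∈S) = cong suc (∣∣-remove S x∈S)
∣∣-remove (outside ∷ S) (Vec.there x∈S) = ∣∣-remove S x∈S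

∉⇒lookup : ∀ {S : Subset n} {x} → x ∉ S → Vec.lookup S x ≡ false
∉⇒lookup {S = S} {x} x∉S = ¬-not (x∉S ∘ lookup⇒[]= x S)

-- Turns a degree into a sum over an explicit list of possible neighbours, both to compute degrees
-- and to express parity. If the head `x` is in `S`, deleting it changes no bit of the tail.
∣∣-support : ∀ (S : Subset n) {xs} → Unique xs → (∀ {x} → x ∈ S → x ∈ˡ xs) →
  ∣ S ∣ ≡ sum (map (bit ∘ Vec.lookup S) xs)
∣∣-support {n} S {[]} [] S⊆ =
  trans (cong ∣_∣ (Empty-unique λ (_ , x∈S) → case S⊆ x∈S of λ ())) (∣⊥∣≡0 n)
∣∣-support S {x ∷ xs} (x∉ ∷ uniq) S⊆ with x ∈? S
... | no x∉S rewrite ∉⇒lookup x∉S = ∣∣-support S uniq λ y∈S → case S⊆ y∈S of λ where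
        (here refl) → contradiction y∈S x∉S
        (there y∈)  → y∈
... | yes x∈S rewrite []=⇒lookup x∈S = trans (∣∣-remove S x∈S) (cong suc
        (trans (∣∣-support S′ uniq S′⊆) (cong sum (map-cong-local (All.map unchanged x∉)))))
  where
  S′ = S [ x ]≔ outside
  unchanged : ∀ {y} → x ≢ y → bit (Vec.lookup S′ y) ≡ bit (Vec.lookup S y)
  unchanged x≢y = cong bit (lookup∘update′ (x≢y ∘ sym) S outside)
  S′⊆ : ∀ {y} → y ∈ S′ → y ∈ˡ xs
  S′⊆ {y} y∈S′ with x ≟ y
  ... | yes refl = case trans (sym ([]=⇒lookup y∈S′)) (lookup∘update x S outside) of λ ()
  ... | no  x≢y
        with S⊆ (lookup⇒[]= y S (trans (sym (lookup∘update′ (x≢y ∘ sym) S outside)) ([]=⇒lookup y∈S′)))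
  ...   | here refl = contradiction refl x≢y
  ...   | there y∈  = y∈

sum-bits : ∀ {S : Subset n} {xs} → All (_∈ S) xs → sum (map (bit ∘ Vec.lookup S) xs) ≡ length xs
sum-bits []           = refl
sum-bits (x∈S ∷ xs∈S) rewrite []=⇒lookup x∈S = cong suc (sum-bits xs∈S)

module _ {P : Fin n → Set} (P? : ∀ x → Dec (P x)) where

  ∈-tabulate⁺ : ∀ {x} → P x → x ∈ tabulate (does ∘ P?)
  ∈-tabulate⁺ {x} px = lookup⇒[]= x _ (trans (lookup∘tabulate (does ∘ P?) x) (dec-true (P? x) px))

  ∈-tabulate⁻ : ∀ {x} → x ∈ tabulate (does ∘ P?) → P x
  ∈-tabulate⁻ {x} x∈ with P? x | trans (sym (lookup∘tabulate (does ∘ P?) x)) ([]=⇒lookup x∈)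
  ... | yes px | _ = px

star-closed : ∀ {a} {A : Set a} {R : Rel A 0ℓ} {C : A → Set} →
  (∀ {x y} → C x → R x y → C y) → ∀ {x y} → C x → Star R x y → C y
star-closed step c ε        = c
star-closed step c (r ◅ rs) = star-closed step (step c r) rs

-- Components and excess

module _ (F : Graph n) where

  reachable-sym : ∀ {u v} → Reachable F u v → Reachable F v u
  reachable-sym = reverse (Graph.sym F)

  ∈-component⁺ : ∀ {u v} → Reachable F u v → v ∈ component F u
  ∈-component⁺ = ∈-tabulate⁺ (reachable? F _)

  ∈-component⁻ : ∀ {u v} → v ∈ component F u → Reachable F u v
  ∈-component⁻ = ∈-tabulate⁻ (reachable? F _)

  component≡⇒reachable : ∀ {u v} → component F u ≡ component F v → Reachable F u v
  component≡⇒reachable eq = ∈-component⁻ (subst (_ ∈_) (sym eq) (∈-component⁺ ε))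

  reachable⇒component≡ : ∀ {u v} → Reachable F u v → component F u ≡ component F v
  reachable⇒component≡ r = ⊆-antisym
    (λ w∈ → ∈-component⁺ (reachable-sym r ◅◅ ∈-component⁻ w∈))
    (λ w∈ → ∈-component⁺ (r ◅◅ ∈-component⁻ w∈))

  degree≢0⇒adj : ∀ {v} → degree F v ≢ 0 → ∃[ w ] Adj F v w
  degree≢0⇒adj {v} deg≢0 with nonempty? (nbhd F v)
  ... | yes w   = w
  ... | no none = contradiction (trans (cong ∣_∣ (Empty-unique none)) (∣⊥∣≡0 n)) deg≢0

  adj⇒component-nontrivial : ∀ {v w} → Adj F v w → 2 ≤ ∣ component F v ∣
  adj⇒component-nontrivial {v} {w} v∼w = begin
    2                                         ≤⟨ s≤s (s≤s z≤n) ⟩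
    2 + ∣ C [ v ]≔ outside [ w ]≔ outside ∣   ≡⟨ cong suc (∣∣-remove (C [ v ]≔ outside) w∈) ⟨
    1 + ∣ C [ v ]≔ outside ∣                  ≡⟨ ∣∣-remove C (∈-component⁺ ε) ⟨
    ∣ C ∣                                     ∎
    where
    open ≤-Reasoning
    C = component F v
    w≢v : w ≢ v
    w≢v refl = Graph.irrefl F v∼w
    w∈ : w ∈ C [ v ]≔ outside
    w∈ = lookup⇒[]= w _ (trans (lookup∘update′ w≢v C outside) ([]=⇒lookup (∈-component⁺ (v∼w ◅ ε))))

  components-lower : ∀ {rs} → Unique (map (component F) rs) →
    All (λ r → 2 ≤ ∣ component F r ∣) rs → length rs ≤ nontrivialComponents F
  components-lower {rs} uniq nontrivial = subst (_≤ nontrivialComponents F) (length-map (component F) rs)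
    (unique-⊆⇒length≤ uniq λ S∈ → case ∈-map⁻ (component F) S∈ of λ where
      (r , r∈rs , refl) → ∈-filter⁺ _ (∈-deduplicate⁺ (≡-dec _≟ᵇ_) (∈-map⁺ (component F) (∈-allFin r)))
        (All.lookup nontrivial r∈rs))

  components-upper : ∀ rs → (∀ v → ∃[ r ] r ∈ˡ rs × Reachable F v r) → nontrivialComponents F ≤ length rs
  components-upper rs reach = subst (nontrivialComponents F ≤_) (length-map (component F) rs)
    (≤-trans (length-filter _ (components F))
      (unique-⊆⇒length≤ (deduplicate-! (≡-dec _≟ᵇ_) (map (component F) (allFin n))) λ S∈ →
        case ∈-map⁻ (component F) (∈-deduplicate⁻ (≡-dec _≟ᵇ_) (map (component F) (allFin n)) S∈) of λ where
          (v , _ , refl) → case reach v of λ where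
            (r , r∈rs , v⇝r) → subst (_∈ˡ map (component F) rs) (sym (reachable⇒component≡ v⇝r))
              (∈-map⁺ (component F) r∈rs)))

  isolated-lower : ∀ {is} → Unique is → All (λ v → degree F v ≡ 0) is → length is ≤ isolatedVertices F
  isolated-lower uniq isolated = unique-⊆⇒length≤ uniq λ v∈is →
    ∈-filter⁺ _ (∈-allFin _) (All.lookup isolated v∈is)

  isolated-none : (∀ v → degree F v ≢ 0) → isolatedVertices F ≡ 0
  isolated-none nonzero = cong length (filter-none _ (All.universal nonzero (allFin n)))

  module _ (pos : Fin n → ℕ) (h : ℕ → ℕ) where

    -- A rank pos cuts the vertices into layers (h k, h (k + 1)].  The components of u and v end in
    -- layer k, hence they differ from every component charged to an earlier layer.
    record ClosedPair (k : ℕ) : Set where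
      field
        {u v}   : Fin n
        u≢v     : u ≢ v
        u-above : h k < pos u
        v-above : h k < pos v
        u-below : ∀ {w} → Reachable F u w → pos w ≤ h (suc k)
        v-below : ∀ {w} → Reachable F v w → pos w ≤ h (suc k)

    private
      -- Evidence for `2 * k ≤ exc F`: representatives of distinct nontrivial components count 2,
      -- isolated vertices count 1. The bounds by `h k` make everything from later layers new.
      record Witnesses (k : ℕ) : Set where
        field
          reps          : List (Fin n)
          isol          : List (Fin n)
          reps-unique   : Unique (map (component F) reps)
          reps-nontriv  : All (λ r → 2 ≤ ∣ component F r ∣) reps
          reps-below    : All (λ r → ∀ w → Reachable F r w → pos w ≤ h k) reps
          isol-unique   : Unique isol
          isol-isolated : All (λ v → degree F v ≡ 0) isol
          isol-below    : All (λ v → pos v ≤ h k) isol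
          weight        : 2 * k ≡ 2 * length reps + length isol

      -- A vertex of the pair with a neighbour represents a new nontrivial component; otherwise both
      -- vertices are isolated. Either way the weight grows by 2.
      extend : ∀ {k} → Witnesses k → ClosedPair k → Witnesses (suc k)
      extend {k} W pair = case (degree F u ≟ⁿ 0) of λ where
          (no u≢0) → add-rep u u≢0 u-above u-below
          (yes u≡0) → case (degree F v ≟ⁿ 0) of λ where
            (no v≢0) → add-rep v v≢0 v-above v-below
            (yes v≡0) → record
              { Witnesses W
              ; isol          = u ∷ v ∷ isol
              ; reps-below    = reps-below′
              ; isol-unique   = (u≢v ∷ All.map (fresh u-above) isol-below)
                              ∷ All.map (fresh v-above) isol-below ∷ isol-unique
              ; isol-isolated = u≡0 ∷ v≡0 ∷ isol-isolated
              ; isol-below    = u-below ε ∷ v-below ε ∷ isol-below′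
              ; weight        = trans (*-suc 2 k) (trans (cong (2 +_) weight)
                  (sym (trans (+-suc _ _) (cong suc (+-suc _ _)))))
              }
        where
        open Witnesses W
        open ClosedPair pair
        layer≤ : h k ≤ h (suc k)
        -- `u` lies in its own component, hence in the layer.
        layer≤ = ≤-trans (<⇒≤ u-above) (u-below ε)
        reps-below′ : All (λ r → ∀ w → Reachable F r w → pos w ≤ h (suc k)) reps
        reps-below′ = All.map (λ below w r⇝w → ≤-trans (below w r⇝w) layer≤) reps-below
        isol-below′ : All (λ w → pos w ≤ h (suc k)) isol
        isol-below′ = All.map (λ below → ≤-trans below layer≤) isol-below
        fresh : ∀ {x y} → h k < pos x → pos y ≤ h k → x ≢ y
        fresh above below refl = <⇒≱ above below
        add-rep : ∀ r → degree F r ≢ 0 → h k < pos r →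
          (∀ {w} → Reachable F r w → pos w ≤ h (suc k)) → Witnesses (suc k)
        add-rep r r≢0 above below = record
          { Witnesses W
          ; reps         = r ∷ reps
          -- An equal component would make `r` reachable from an earlier representative, so that its
          -- rank would be at most `h k`.
          ; reps-unique  = All-map⁺ (All.map (λ below′ eq →
              <⇒≱ above (below′ r (component≡⇒reachable (sym eq)))) reps-below) ∷ reps-unique
          ; reps-nontriv = adj⇒component-nontrivial (proj₂ (degree≢0⇒adj r≢0)) ∷ reps-nontriv
          ; reps-below   = (λ _ → below) ∷ reps-below′
          ; isol-below   = isol-below′
          ; weight       = trans (*-suc 2 k) (trans (cong (2 +_) weight)
              (cong (_+ length isol) (sym (*-suc 2 (length reps)))))
          }

      witnesses : ∀ k → (∀ i → i < k → ClosedPair i) → Witnesses k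
      witnesses zero    _    = record
        { reps = [] ; isol = [] ; reps-unique = [] ; reps-nontriv = [] ; reps-below = []
        ; isol-unique = [] ; isol-isolated = [] ; isol-below = [] ; weight = refl }
      witnesses (suc k) pair = extend (witnesses k λ i i<k → pair i (m<n⇒m<1+n i<k)) (pair k (n<1+n k))

    exc-lower : ∀ k → (∀ i → i < k → ClosedPair i) → 2 * k ≤ exc F
    exc-lower k pair = subst (_≤ exc F) (sym weight)
      (+-mono-≤ (*-monoʳ-≤ 2 (components-lower reps-unique reps-nontriv)) (isolated-lower isol-unique isol-isolated))
      where open Witnesses (witnesses k pair)

-- 2-connectivity

-- Supplies a bound `B` on the ranks, so that `B ∸ rank x` is a decreasing measure for upward walks.
bounded : (f : Fin n → ℕ) → ∃[ b ] (∀ x → f x ≤ b)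
bounded {zero}  f = 0 , λ ()
bounded {suc n} f with bounded (f ∘ suc)
... | b , f≤b = f zero ⊔ b , λ where
  zero    → m≤m⊔n (f zero) b
  (suc x) → ≤-trans (f≤b x) (m≤n⊔m (f zero) b)

-- Well-founded recursion on `μ`; the invariant `P` will keep the walk away from a deleted vertex.
descend : ∀ {A : Set} {R : Rel A 0ℓ} {P : A → Set} {b} (μ : A → ℕ) →
  (∀ {x} → P x → x ≡ b ⊎ ∃[ y ] P y × R x y × μ y < μ x) →
  ∀ {x} → P x → P b × Star R x b
descend {A} {R} {P} {b} μ step p = go p (<-wellFounded _)
  where
  go : ∀ {x} → P x → Acc _<_ (μ x) → P b × Star R x b
  go p (acc rec) with step p
  ... | inj₁ refl                = p , ε
  ... | inj₂ (y , q , r , y<x) = case go q (rec y<x) of λ where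
    (p′ , rs) → p′ , r ◅ rs

-- With such an st-numbering, one can walk from any vertex other than w monotonically away from
-- the rank of w until reaching the bottom or the top, and these two are adjacent.
module _ (G : Graph n) (rank : Fin n → ℕ) {bottom top : Fin n} (bottom∼top : Adj G bottom top)
  (down : ∀ x → x ≡ bottom ⊎ ∃[ y ] Adj G x y × rank y < rank x)
  (up : ∀ x → x ≡ top ⊎ ∃[ y ] Adj G x y × rank x < rank y) where

  st-connected : Connected G
  st-connected u v = toBottom u ◅◅ reachable-sym G (toBottom v)
    where
    toBottom : ∀ x → Reachable G x bottom
    toBottom x = proj₂ (descend {P = λ _ → ⊤} rank
      (λ {x} _ → case down x of λ where
        (inj₁ eq)             → inj₁ eq
        (inj₂ (y , x∼y , y<x)) → inj₂ (y , tt , x∼y , y<x)) tt)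

  st-connectedWithout : ∀ w → ConnectedWithout G w
  st-connectedWithout w u v u≢w v≢w = join (anchor u≢w) (anchor v≢w)
    where
    Path : Rel (Fin n) 0ℓ
    Path = Star (AdjWithout G w)

    symm : ∀ {x y} → Path x y → Path y x
    symm = reverse λ (x≢w , y≢w , x∼y) → y≢w , x≢w , Graph.sym G x∼y

    B = proj₁ (bounded rank)

    -- Ties with `rank w` go down: after one step the rank is strictly below `rank w`.
    low : ∀ {x} → rank x ≤ rank w × x ≢ w → (rank bottom ≤ rank w × bottom ≢ w) × Path x bottom
    low = descend rank λ {x} (x≤w , x≢w) → case down x of λ where
      (inj₁ eq)              → inj₁ eq
      (inj₂ (y , x∼y , y<x)) → let y<w = <-≤-trans y<x x≤w ; y≢w = λ { refl → <-irrefl refl y<w } in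
        inj₂ (y , (<⇒≤ y<w , y≢w) , (x≢w , y≢w , x∼y) , y<x)

    high : ∀ {x} → rank w < rank x → rank w < rank top × Path x top
    high = descend (λ x → B ∸ rank x) λ {x} w<x → case up x of λ where
      (inj₁ eq)              → inj₁ eq
      (inj₂ (y , x∼y , x<y)) → let w<y = <-trans w<x x<y in
        inj₂ (y , w<y , ((λ { refl → <-irrefl refl w<x }) , (λ { refl → <-irrefl refl w<y }) , x∼y)
               , ∸-monoʳ-< x<y (proj₂ (bounded rank) y))

    Anchor : Fin n → Set
    Anchor x = (bottom ≢ w × Path x bottom) ⊎ (top ≢ w × Path x top)

    anchor : ∀ {x} → x ≢ w → Anchor x
    anchor {x} x≢w with rank x ≤? rank w
    ... | yes x≤w = case low (x≤w , x≢w) of λ { ((_ , b≢w) , p) → inj₁ (b≢w , p) }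
    ... | no  x≰w = case high (≰⇒> x≰w) of λ { (w<t , p) → inj₂ ((λ { refl → <-irrefl refl w<t }) , p) }

    join : ∀ {x y} → Anchor x → Anchor y → Path x y
    join (inj₁ (_ , p))   (inj₁ (_ , q))   = p ◅◅ symm q
    -- One walk ends at the bottom and the other at the top; neither end is `w`, so the edge
    -- `bottom∼top` survives and joins them.
    join (inj₁ (b≢w , p)) (inj₂ (t≢w , q)) = p ◅◅ (b≢w , t≢w , bottom∼top) ◅ symm q
    join (inj₂ (t≢w , p)) (inj₁ (b≢w , q)) = p ◅◅ (t≢w , b≢w , Graph.sym G bottom∼top) ◅ symm q
    join (inj₂ (_ , p))   (inj₂ (_ , q))   = p ◅◅ symm q

-- Graphs given by neighbour lists

module Coded {V : Set} (code : V ↔ Fin n) where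

  open Inverse code public using (to; from; strictlyInverseˡ; strictlyInverseʳ)

  to-injective : ∀ {u v} → to u ≡ to v → u ≡ v
  to-injective {u} {v} eq = trans (sym (strictlyInverseʳ u)) (trans (cong from eq) (strictlyInverseʳ v))

  ∀-code : {P : Fin n → Set} → (∀ v → P (to v)) → ∀ x → P x
  ∀-code {P} p x = subst P (strictlyInverseˡ x) (p (from x))

  module FromNeighbours (N : V → List V)
    (N-sym : ∀ {u v} → v ∈ˡ N u → u ∈ˡ N v) (N-irrefl : ∀ {v} → v ∉ˡ N v) where

    private
      nbr? : ∀ x y → Dec (y ∈ˡ map to (N (from x)))
      nbr? x y = DecMembership._∈?_ _≟_ y (map to (N (from x)))

      nbr⁻ : ∀ {x y} → y ∈ˡ map to (N (from x)) → from y ∈ˡ N (from x)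
      nbr⁻ y∈ = case ∈-map⁻ to y∈ of λ where
        (v , v∈ , refl) → subst (_∈ˡ _) (sym (strictlyInverseʳ v)) v∈

      nbr⁺ : ∀ {x y} → from y ∈ˡ N (from x) → y ∈ˡ map to (N (from x))
      nbr⁺ {y = y} y∈ = subst (_∈ˡ _) (strictlyInverseˡ y) (∈-map⁺ to y∈)

    graph : Graph n
    graph = record
      { nbhd   = λ x → tabulate (does ∘ nbr? x)
      ; sym    = λ {x} {y} y∈ → ∈-tabulate⁺ (nbr? y) (nbr⁺ (N-sym (nbr⁻ (∈-tabulate⁻ (nbr? x) y∈))))
      ; irrefl = λ {x} x∈ → N-irrefl (nbr⁻ (∈-tabulate⁻ (nbr? x) x∈))
      }

    adj⁻ : ∀ {x y} → Adj graph x y → from y ∈ˡ N (from x)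
    adj⁻ {x} x∼y = nbr⁻ (∈-tabulate⁻ (nbr? x) x∼y)

    adj⁺ : ∀ {x y} → from y ∈ˡ N (from x) → Adj graph x y
    adj⁺ {x} y∈ = ∈-tabulate⁺ (nbr? x) (nbr⁺ y∈)

    adj-to⁺ : ∀ {u v} → v ∈ˡ N u → Adj graph (to u) (to v)
    adj-to⁺ {u} {v} v∈ = adj⁺ (subst₂ (λ u v → v ∈ˡ N u) (sym (strictlyInverseʳ u)) (sym (strictlyInverseʳ v)) v∈)

    degree-graph : (∀ v → Unique (N v)) → ∀ x → degree graph x ≡ length (N (from x))
    degree-graph N-unique x = trans
      (∣∣-support (nbhd graph x) (Unique.map⁺ to-injective (N-unique (from x))) (∈-tabulate⁻ (nbr? x)))
      (trans (sum-bits (All.tabulate (∈-tabulate⁺ (nbr? x)))) (length-map to (N (from x))))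

-- The ladder graph

-- Vertices are pairs of a site (a diamond or an inner block) and an element of a 2 × 2 table, the last
-- component r being the rail: A d r and M d r are the vertices of degree 2 and 3 in the diamond d,
-- and P i r, Q i r are the rail vertices of the block i.
pattern left  = zero
pattern right = suc zero
pattern mid i = suc (suc i)

pattern A d r = inj₁ d , 0F , r
pattern M d r = inj₁ d , 1F , r
pattern P i r = inj₂ i , 0F , r
pattern Q i r = inj₂ i , 1F , r

module Ladder (j : ℕ) where

  Vertex : Set
  Vertex = (Fin (2 + j) ⊎ Fin j) × Fin 2 × Fin 2

  -- Four vertices per site, so `size / 4` is the number of sites.
  size : ℕ
  size = (2 + j + j) * 4

  abstract
    code : Vertex ↔ Fin size
    code = ↔-sym ((+↔⊎ ×-↔ *↔×) ↔-∘ *↔×)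

  open Coded code

  -- The gap g lies before the block g; the last gap is followed by the right diamond.
  leftV : Fin (suc j) → Fin 2 → Vertex
  leftV zero    r = A left r
  leftV (suc i) r = Q i r

  rightV′ : ∀ {g : Fin (suc j)} → View g → Fin 2 → Vertex
  rightV′ ‵fromℕ      r = A right r
  rightV′ (‵inject₁ i) r = P i r

  rightV : Fin (suc j) → Fin 2 → Vertex
  rightV g = rightV′ (view g)

  rightV-fromℕ : ∀ r → rightV (fromℕ j) r ≡ A right r
  rightV-fromℕ r rewrite view-fromℕ j = refl

  rightV-inject₁ : ∀ i r → rightV (inject₁ i) r ≡ P i r
  rightV-inject₁ i r rewrite view-inject₁ i = refl

  -- The neighbour of `A d r` outside its diamond.
  port : Fin (2 + j) → Fin 2 → Vertex
  port left    r = rightV zero r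
  port right   r = leftV (fromℕ j) r
  port (mid i) r = Q i r

  -- Deleting the perfect matching of the chords leaves the optimal 2-factor: gap g lies on a cycle of
  -- its own, which turns back through the diamond on its left, and on its right through an edge P₀P₁
  -- or the right diamond.
  chord : Vertex → Vertex
  chord (A d r) = M d (opposite r)
  chord (M d r) = A d (opposite r)
  chord (P i r) = Q i r
  chord (Q i r) = P i r

  factor : Vertex → List Vertex
  factor (A d r) = port d r ∷ M d r ∷ []
  factor (M d r) = A d r ∷ M d (opposite r) ∷ []
  factor (P i r) = leftV (inject₁ i) r ∷ P i (opposite r) ∷ []
  factor (Q i r) = A (mid i) r ∷ rightV (suc i) r ∷ []

  -- With the chord at the head, uniqueness, irreflexivity and length for the 2-factor follow by
  -- passing to the tail.
  nbrs : Vertex → List Vertex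
  nbrs v = chord v ∷ factor v

  leftV∈ : ∀ g r → leftV g r ∈ˡ factor (rightV g r)
  leftV∈ g r with view g
  ... | ‵fromℕ     = here refl
  ... | ‵inject₁ i = here refl

  rightV∈ : ∀ g r → rightV g r ∈ˡ factor (leftV g r)
  rightV∈ zero    r = here refl
  rightV∈ (suc i) r = there (here refl)

  factor-sym : ∀ {u v} → v ∈ˡ factor u → u ∈ˡ factor v
  factor-sym {A left r}    (here refl)         = leftV∈ zero r
  factor-sym {A right r}   (here refl)         =
    subst (_∈ˡ factor (leftV (fromℕ j) r)) (rightV-fromℕ r) (rightV∈ (fromℕ j) r)
  factor-sym {A (mid i) r} (here refl)         = here refl
  factor-sym {A d r}       (there (here refl)) = here refl
  factor-sym {M d r}       (here refl)         = there (here refl)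
  factor-sym {M d 0F}      (there (here refl)) = there (here refl)
  factor-sym {M d 1F}      (there (here refl)) = there (here refl)
  factor-sym {P i r}       (here refl)         =
    subst (_∈ˡ factor (leftV (inject₁ i) r)) (rightV-inject₁ i r) (rightV∈ (inject₁ i) r)
  factor-sym {P i 0F}      (there (here refl)) = there (here refl)
  factor-sym {P i 1F}      (there (here refl)) = there (here refl)
  factor-sym {Q i r}       (here refl)         = here refl
  factor-sym {Q i r}       (there (here refl)) = leftV∈ (suc i) r

  chord-involutive : ∀ v → chord (chord v) ≡ v
  chord-involutive (A d 0F) = refl
  chord-involutive (A d 1F) = refl
  chord-involutive (M d 0F) = refl
  chord-involutive (M d 1F) = refl
  chord-involutive (P i r)  = refl
  chord-involutive (Q i r)  = refl

  nbrs-sym : ∀ {u v} → v ∈ˡ nbrs u → u ∈ˡ nbrs v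
  nbrs-sym {u} (here refl) = here (sym (chord-involutive u))
  nbrs-sym     (there v∈)  = there (factor-sym v∈)

  -- Positions along the ladder, and simplicity of the graph

  pos : Vertex → ℕ
  pos (inj₁ left    , _) = 0
  pos (inj₁ right   , _) = suc (j * 2)
  pos (inj₁ (mid i) , _) = 2 + toℕ i * 2
  pos (P i r)            = 1 + toℕ i * 2
  pos (Q i r)            = 2 + toℕ i * 2

  -- Gap `g` climbs from position `2 g` to `2 g + 1`, and the edges from `P i r` to `Q i r` climb
  -- from `2 i + 1` to `2 i + 2`. Block `i` thus fills the layer of the positions `2 i + 1` and
  -- `2 i + 2`.
  pos-leftV : ∀ g r → pos (leftV g r) ≡ toℕ g * 2
  pos-leftV zero    r = refl
  pos-leftV (suc i) r = refl

  pos-rightV : ∀ g r → pos (rightV g r) ≡ suc (toℕ g * 2)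
  pos-rightV g r with view g
  ... | ‵fromℕ     = cong (λ k → suc (k * 2)) (sym (toℕ-fromℕ j))
  ... | ‵inject₁ i = cong (λ k → suc (k * 2)) (sym (toℕ-inject₁ i))

  -- `rightV g` and `leftV (fromℕ j)` do not reduce to constructor form for variable `g` and `j`;
  -- positions tell such neighbours apart.
  pos-≢ : ∀ {u v} → pos u ≢ pos v → u ≢ v
  pos-≢ ≢ refl = ≢ refl

  opposite≢ : ∀ {a} {X : Set a} {c : Fin 2 → X} → (∀ {r s} → c r ≡ c s → r ≡ s) → ∀ r → c (opposite r) ≢ c r
  opposite≢ inj 0F eq = case inj eq of λ ()
  opposite≢ inj 1F eq = case inj eq of λ ()

  private
    P-left : ∀ i r → pos (leftV (inject₁ i) r) ≡ toℕ i * 2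
    P-left i r = trans (pos-leftV (inject₁ i) r) (cong (_* 2) (toℕ-inject₁ i))

    right-port : ∀ r → pos (port right r) ≡ j * 2
    right-port r = trans (pos-leftV (fromℕ j) r) (cong (_* 2) (toℕ-fromℕ j))

  port≢M : ∀ d r s → port d r ≢ M d s
  port≢M left    r s = pos-≢ λ eq → case trans (sym (pos-rightV zero r)) eq of λ ()
  port≢M right   r s = pos-≢ λ eq → <⇒≢ (n<1+n _) (trans (sym (right-port r)) eq)
  port≢M (mid i) r s = λ ()

  port≢A : ∀ d r s → port d r ≢ A d s
  port≢A left    r s = pos-≢ λ eq → case trans (sym (pos-rightV zero r)) eq of λ ()
  port≢A right   r s = pos-≢ λ eq → <⇒≢ (n<1+n _) (trans (sym (right-port r)) eq)
  port≢A (mid i) r s = λ ()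

  leftV≢P : ∀ g i r s → leftV g r ≢ P i s
  leftV≢P zero    i r s = λ ()
  leftV≢P (suc g) i r s = λ ()

  leftV≢Q : ∀ i r s → leftV (inject₁ i) r ≢ Q i s
  leftV≢Q i r s = pos-≢ λ eq → <⇒≢ (m<n⇒m<1+n (n<1+n _)) (trans (sym (P-left i r)) eq)

  rightV≢Q : ∀ g i r s → rightV g r ≢ Q i s
  rightV≢Q g i r s with view g
  ... | ‵fromℕ      = λ ()
  ... | ‵inject₁ i′ = λ ()

  rightV≢A : ∀ i r s → rightV (suc i) r ≢ A (mid i) s
  rightV≢A i r s = pos-≢ λ eq → <⇒≢ (n<1+n _) (sym (trans (sym (pos-rightV (suc i) r)) eq))

  rightV≢P : ∀ i r s → rightV (suc i) r ≢ P i s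
  rightV≢P i r s = pos-≢ λ eq → <⇒≢ (m<n⇒m<1+n (n<1+n _)) (sym (trans (sym (pos-rightV (suc i) r)) eq))

  M-injective : ∀ {d : Fin (2 + j)} {r s} → _≡_ {A = Vertex} (M d r) (M d s) → r ≡ s
  M-injective refl = refl

  A-injective : ∀ {d : Fin (2 + j)} {r s} → _≡_ {A = Vertex} (A d r) (A d s) → r ≡ s
  A-injective refl = refl

  P-injective : ∀ {i : Fin j} {r s} → _≡_ {A = Vertex} (P i r) (P i s) → r ≡ s
  P-injective refl = refl

  nbrs-unique : ∀ v → Unique (nbrs v)
  nbrs-unique (A d r) = (port≢M d r _ ∘ sym ∷ opposite≢ M-injective r ∷ []) ∷ (port≢M d r r ∷ []) ∷ [] ∷ []
  nbrs-unique (M d r) = (opposite≢ A-injective r ∷ (λ ()) ∷ []) ∷ ((λ ()) ∷ []) ∷ [] ∷ []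
  nbrs-unique (P i r) = (leftV≢Q i r r ∘ sym ∷ (λ ()) ∷ []) ∷ (leftV≢P (inject₁ i) i r _ ∷ []) ∷ [] ∷ []
  nbrs-unique (Q i r) = ((λ ()) ∷ rightV≢P i r r ∘ sym ∷ []) ∷ (rightV≢A i r r ∘ sym ∷ []) ∷ [] ∷ []

  factor-unique : ∀ v → Unique (factor v)
  factor-unique v with nbrs-unique v
  ... | _ ∷ uniq = uniq

  nbrs-irrefl : ∀ {v} → v ∉ˡ nbrs v
  nbrs-irrefl {A d r} (there (here eq))         = port≢A d r r (sym eq)
  nbrs-irrefl {A d r} (there (there (here ())))
  nbrs-irrefl {M d r} (there (there (here eq))) = opposite≢ M-injective r (sym eq)
  nbrs-irrefl {P i r} (there (here eq))         = leftV≢P (inject₁ i) i r r (sym eq)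
  nbrs-irrefl {P i r} (there (there (here eq))) = opposite≢ P-injective r (sym eq)
  nbrs-irrefl {Q i r} (there (there (here eq))) = rightV≢Q (suc i) i r r (sym eq)

  -- The graph and its 2-factor

  module GN = FromNeighbours nbrs nbrs-sym nbrs-irrefl
  module FN = FromNeighbours factor factor-sym (nbrs-irrefl ∘ there)

  G : Graph size
  G = GN.graph

  TwoFactor : Graph size
  TwoFactor = FN.graph

  length-nbrs : ∀ v → length (nbrs v) ≡ 3
  length-nbrs (A d r) = refl
  length-nbrs (M d r) = refl
  length-nbrs (P i r) = refl
  length-nbrs (Q i r) = refl

  cubic : Cubic G
  cubic x = trans (GN.degree-graph nbrs-unique x) (length-nbrs (from x))

  degree-TwoFactor : ∀ x → degree TwoFactor x ≡ 2
  degree-TwoFactor x = trans (FN.degree-graph factor-unique x) (suc-injective (length-nbrs (from x)))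

  TwoFactor⊆G : SpanningSubgraph TwoFactor G
  TwoFactor⊆G x {y} x∼y = GN.adj⁺ {x} {y} (there (FN.adj⁻ {x} {y} x∼y))

  eulerian : Eulerian TwoFactor
  eulerian x = divides 1 (degree-TwoFactor x)

  -- Only through these edges can an initial segment of positions be left. The constructor `rung`
  -- stands for the rail edges between the two rungs of a block.
  data Increase : Vertex → Vertex → Set where
    gap  : ∀ g r {u v} → u ≡ leftV g r → v ≡ rightV g r → Increase u v
    rung : ∀ i r → Increase (P i r) (Q i r)

  nbr-pos : ∀ u {v} → v ∈ˡ nbrs u → pos v ≤ pos u ⊎ Increase u v
  nbr-pos (A left r)    (there (here refl))         = inj₂ (gap zero r refl refl)
  nbr-pos (A right r)   (there (here refl))         = inj₁ (≤-trans (≤-reflexive (right-port r)) (n≤1+n _))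
  nbr-pos (A (mid i) r) (there (here refl))         = inj₁ ≤-refl
  nbr-pos (A left r)    (here refl)                 = inj₁ ≤-refl
  nbr-pos (A right r)   (here refl)                 = inj₁ ≤-refl
  nbr-pos (A (mid i) r) (here refl)                 = inj₁ ≤-refl
  nbr-pos (A left r)    (there (there (here refl))) = inj₁ ≤-refl
  nbr-pos (A right r)   (there (there (here refl))) = inj₁ ≤-refl
  nbr-pos (A (mid i) r) (there (there (here refl))) = inj₁ ≤-refl
  nbr-pos (M left r)    (here refl)                 = inj₁ ≤-refl
  nbr-pos (M right r)   (here refl)                 = inj₁ ≤-refl
  nbr-pos (M (mid i) r) (here refl)                 = inj₁ ≤-refl
  nbr-pos (M left r)    (there (here refl))         = inj₁ ≤-refl
  nbr-pos (M right r)   (there (here refl))         = inj₁ ≤-refl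
  nbr-pos (M (mid i) r) (there (here refl))         = inj₁ ≤-refl
  nbr-pos (M left r)    (there (there (here refl))) = inj₁ ≤-refl
  nbr-pos (M right r)   (there (there (here refl))) = inj₁ ≤-refl
  nbr-pos (M (mid i) r) (there (there (here refl))) = inj₁ ≤-refl
  nbr-pos (P i r)       (here refl)                 = inj₂ (rung i r)
  nbr-pos (P i r)       (there (here refl))         = inj₁ (≤-trans (≤-reflexive (P-left i r)) (n≤1+n _))
  nbr-pos (P i r)       (there (there (here refl))) = inj₁ ≤-refl
  nbr-pos (Q i r)       (here refl)                 = inj₁ (n≤1+n _)
  nbr-pos (Q i r)       (there (here refl))         = inj₁ ≤-refl
  nbr-pos (Q i r)       (there (there (here refl))) = inj₂ (gap (suc i) r refl refl)

  -- Upper bound: the cycles of the 2-factor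

  toLeftV : ∀ v → ∃[ g ] Star (λ a b → b ∈ˡ factor a) v (leftV g 0F)
  toLeftV (A left 0F)    = zero , ε
  toLeftV (A left 1F)    = zero , there (here refl) ◅ there (here refl) ◅ here refl ◅ ε
  toLeftV (A right 0F)   = fromℕ j , here refl ◅ ε
  toLeftV (A right 1F)   = fromℕ j , there (here refl) ◅ there (here refl) ◅ here refl ◅ here refl ◅ ε
  toLeftV (A (mid i) 0F) = suc i , here refl ◅ ε
  toLeftV (A (mid i) 1F) = suc i , there (here refl) ◅ there (here refl) ◅ here refl ◅ here refl ◅ ε
  toLeftV (M left 0F)    = zero , here refl ◅ ε
  toLeftV (M left 1F)    = zero , there (here refl) ◅ here refl ◅ ε
  toLeftV (M right 0F)   = fromℕ j , here refl ◅ here refl ◅ ε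
  toLeftV (M right 1F)   = fromℕ j , there (here refl) ◅ here refl ◅ here refl ◅ ε
  toLeftV (M (mid i) 0F) = suc i , here refl ◅ here refl ◅ ε
  toLeftV (M (mid i) 1F) = suc i , there (here refl) ◅ here refl ◅ here refl ◅ ε
  toLeftV (P i 0F)       = inject₁ i , here refl ◅ ε
  toLeftV (P i 1F)       = inject₁ i , there (here refl) ◅ here refl ◅ ε
  toLeftV (Q i 0F)       = suc i , ε
  toLeftV (Q i 1F)       = suc i , here refl ◅ there (here refl) ◅ there (here refl) ◅ here refl ◅ here refl ◅ ε

  reachable-to : ∀ {u v} → Star (λ a b → b ∈ˡ factor a) u v → Reachable TwoFactor (to u) (to v)
  reachable-to ε        = ε
  reachable-to (e ◅ es) = FN.adj-to⁺ e ◅ reachable-to es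

  -- One representative per gap, on the cycle belonging to that gap.
  reps : List (Fin size)
  reps = map (λ g → to (leftV g 0F)) (allFin (suc j))

  length-reps : length reps ≡ suc j
  length-reps = trans (length-map (λ g → to (leftV g 0F)) (allFin (suc j))) (length-tabulate {n = suc j} (λ g → g))

  exc-TwoFactor : exc TwoFactor ≤ 2 * suc j
  exc-TwoFactor = begin
    2 * nontrivialComponents TwoFactor + isolatedVertices TwoFactor
      ≡⟨ cong (2 * nontrivialComponents TwoFactor +_) (isolated-none TwoFactor λ x eq →
           case trans (sym eq) (degree-TwoFactor x) of λ ()) ⟩
    2 * nontrivialComponents TwoFactor + 0
      ≡⟨ +-identityʳ _ ⟩
    2 * nontrivialComponents TwoFactor
      ≤⟨ *-monoʳ-≤ 2 (components-upper TwoFactor reps (∀-code λ v → let g , v⇝ = toLeftV v in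
           to (leftV g 0F) , ∈-map⁺ (λ g → to (leftV g 0F)) (∈-allFin g) , reachable-to v⇝)) ⟩
    2 * length reps
      ≡⟨ cong (2 *_) length-reps ⟩
    2 * suc j ∎
    where open ≤-Reasoning

  -- Lower bound for spanning Eulerian subgraphs

  module Lower (F : Graph size) (F⊆G : SpanningSubgraph F G) (F-eulerian : Eulerian F) where

    -- Boolean indicators, so that even degree at a cubic vertex becomes an equation with `xor`.
    edge : Vertex → Vertex → Bool
    edge u v = Vec.lookup (nbhd F (to u)) (to v)

    edge-sym : ∀ u v → edge u v ≡ edge v u
    edge-sym u v with edge u v in uv | edge v u in vu
    ... | true  | true  = refl
    ... | false | false = refl
    ... | true  | false = trans (sym ([]=⇒lookup (Graph.sym F (lookup⇒[]= _ _ uv)))) vu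
    ... | false | true  = trans (sym uv) ([]=⇒lookup (Graph.sym F (lookup⇒[]= _ _ vu)))

    adj⇒nbr : ∀ {x y} → Adj F x y → from y ∈ˡ nbrs (from x)
    adj⇒nbr {x} {y} x∼y = GN.adj⁻ {x} {y} (F⊆G x x∼y)

    adj⇒edge : ∀ {x y} → Adj F x y → edge (from x) (from y) ≡ true
    adj⇒edge {x} {y} x∼y = []=⇒lookup (subst₂ (Adj F) (sym (strictlyInverseˡ x)) (sym (strictlyInverseˡ y)) x∼y)

    degree-edges : ∀ v → degree F (to v) ≡ sum (map (bit ∘ edge v) (nbrs v))
    degree-edges v = trans (∣∣-support (nbhd F (to v)) (Unique.map⁺ to-injective (nbrs-unique v)) nbr)
      (cong sum (sym (map-∘ (nbrs v))))
      where
      nbr : ∀ {y} → Adj F (to v) y → y ∈ˡ map to (nbrs v)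
      nbr {y} v∼y = subst (_∈ˡ map to (nbrs v)) (strictlyInverseˡ y)
        (∈-map⁺ to (subst (λ u → from y ∈ˡ nbrs u) (strictlyInverseʳ v) (adj⇒nbr v∼y)))

    even-bits : ∀ a b c → 2 ∣ bit a + (bit b + (bit c + 0)) → a ≡ b xor c
    even-bits false false false _   = refl
    even-bits false true  true  _   = refl
    even-bits true  false true  _   = refl
    even-bits true  true  false _   = refl
    even-bits false false true  odd = contradiction odd (from-no (2 ∣? 1))
    even-bits false true  false odd = contradiction odd (from-no (2 ∣? 1))
    even-bits true  false false odd = contradiction odd (from-no (2 ∣? 1))
    even-bits true  true  true  odd = contradiction odd (from-no (2 ∣? 3))

    even-at : ∀ v {x y z} → nbrs v ≡ x ∷ y ∷ z ∷ [] → edge v x ≡ edge v y xor edge v z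
    even-at v {x} {y} {z} eq = even-bits (edge v x) (edge v y) (edge v z)
      (subst (2 ∣_) (trans (degree-edges v) (cong (sum ∘ map (bit ∘ edge v)) eq)) (F-eulerian (to v)))

    even-A : ∀ d r → edge (A d r) (M d (opposite r)) ≡ edge (A d r) (port d r) xor edge (A d r) (M d r)
    even-A d r = even-at (A d r) refl

    even-M : ∀ d r → edge (A d (opposite r)) (M d r) ≡ edge (A d r) (M d r) xor edge (M d r) (M d (opposite r))
    even-M d r = trans (edge-sym _ _) (trans (even-at (M d r) refl)
      (cong (_xor edge (M d r) (M d (opposite r))) (edge-sym _ _)))

    even-P : ∀ i r → edge (P i r) (Q i r) ≡
      edge (leftV (inject₁ i) r) (rightV (inject₁ i) r) xor edge (P i r) (P i (opposite r))
    even-P i r = trans (even-at (P i r) refl)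
      (cong (_xor edge (P i r) (P i (opposite r)))
        (trans (edge-sym _ _) (cong (edge (leftV (inject₁ i) r)) (sym (rightV-inject₁ i r)))))

    even-Q : ∀ i r → edge (P i r) (Q i r) ≡ edge (A (mid i) r) (Q i r) xor edge (Q i r) (rightV (suc i) r)
    even-Q i r = trans (edge-sym _ _) (trans (even-at (Q i r) refl)
      (cong (_xor edge (Q i r) (rightV (suc i) r)) (edge-sym _ _)))

    private
      xor-solve : ∀ {a b c} → a ≡ b xor c → b ≡ a xor c
      xor-solve {b = false} {false} refl = refl
      xor-solve {b = false} {true}  refl = refl
      xor-solve {b = true}  {false} refl = refl
      xor-solve {b = true}  {true}  refl = refl

      xor-solve′ : ∀ {a b c} → a ≡ b xor c → c ≡ b xor a
      xor-solve′ {b = false} {false} refl = refl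
      xor-solve′ {b = false} {true}  refl = refl
      xor-solve′ {b = true}  {false} refl = refl
      xor-solve′ {b = true}  {true}  refl = refl

      xor-swap : ∀ p₀ p₁ m → (p₁ xor m) xor p₀ ≡ (p₀ xor m) xor p₁
      xor-swap false false m     = refl
      xor-swap true  true  m     = refl
      xor-swap false true  false = refl
      xor-swap false true  true  = refl
      xor-swap true  false false = refl
      xor-swap true  false true  = refl

      -- Here `x` are the port edges, `p` and `q` the edges from an `A` to the `M` on the same and
      -- on the opposite rail, and `m` joins the two `M`s. Adding the four equations cancels `p`,
      -- `q` and `m`.
      diamond-parity : ∀ {x₀ x₁ p₀ p₁ q₀ q₁ m} → q₀ ≡ x₀ xor p₀ → q₁ ≡ x₁ xor p₁ →
        q₁ ≡ p₀ xor m → q₀ ≡ p₁ xor m → x₀ ≡ x₁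
      diamond-parity {p₀ = p₀} {p₁} {m = m} eq₀ eq₁ refl refl =
        trans (xor-solve eq₀) (trans (xor-swap p₀ p₁ m) (sym (xor-solve eq₁)))

    diamond-balanced : ∀ d → edge (A d 0F) (port d 0F) ≡ edge (A d 1F) (port d 1F)
    diamond-balanced d = diamond-parity (even-A d 0F) (even-A d 1F) (even-M d 0F)
      (trans (even-M d 1F) (cong (edge (A d 1F) (M d 1F) xor_) (edge-sym (M d 1F) (M d 0F))))

    gap-edge : Fin (suc j) → Fin 2 → Bool
    gap-edge g r = edge (leftV g r) (rightV g r)

    -- The parity conditions at `P i 0F` and `P i 1F` share the edge between these vertices, so
    -- equal gap edges force equal edges to the `Q`s.
    rung-balanced : ∀ i → gap-edge (inject₁ i) 0F ≡ gap-edge (inject₁ i) 1F →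
      edge (P i 0F) (Q i 0F) ≡ edge (P i 1F) (Q i 1F)
    rung-balanced i eq = trans (even-P i 0F)
      (trans (cong₂ _xor_ eq (edge-sym (P i 0F) (P i 1F))) (sym (even-P i 1F)))

    -- Induction from the left diamond: parity at `Q i r` makes the next gap edge the `xor` of its
    -- port edge and of its edge to `P i r`, both balanced already.
    gap-balanced : ∀ g → gap-edge g 0F ≡ gap-edge g 1F
    gap-balanced = <-weakInduction _ (diamond-balanced left) λ i eq →
      trans (xor-solve′ {b = edge (A (mid i) 0F) (Q i 0F)} (even-Q i 0F))
        (trans (cong₂ _xor_ (diamond-balanced (mid i)) (rung-balanced i eq))
          (sym (xor-solve′ {b = edge (A (mid i) 1F) (Q i 1F)} (even-Q i 1F))))

    -- As `F` is symmetric, such a `C` is a union of vertex sets of components of `F`.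
    Step : (Vertex → Set) → Set
    Step C = ∀ {u v} → C u → v ∈ˡ nbrs u → edge u v ≡ true → C v

    reachable-closed : ∀ {C} → Step C → ∀ {u w} → C u → Reachable F (to u) w → C (from w)
    reachable-closed {C} step {u} c = star-closed {C = C ∘ from}
      (λ c x∼y → step c (adj⇒nbr x∼y) (adj⇒edge x∼y)) (subst C (sym (strictlyInverseʳ u)) c)

    private
      ≤⇒suc*2≤ : ∀ {m n} → m ≤ n → m ≢ n → suc m * 2 ≤ n * 2
      ≤⇒suc*2≤ m≤n m≢n = *-monoˡ-≤ 2 (≤∧≢⇒< m≤n m≢n)

      *2<suc*2⇒≤ : ∀ {m n} → m * 2 < suc n * 2 → m ≤ n
      *2<suc*2⇒≤ {m} {n} lt = s≤s⁻¹ (*-cancelʳ-< 2 m (suc n) lt)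

    -- An earlier gap ends below `2 g`, and an edge of type `rung` from `2 i + 1 ≤ 2 g` ends at
    -- `2 i + 2`, still at most `2 g` by parity. Only gap `g` would leave.
    gap-closed : ∀ g → (∀ r → gap-edge g r ≡ false) → Step (λ v → pos v ≤ toℕ g * 2)
    gap-closed g absent {u} u≤ v∈ present with nbr-pos u v∈
    ... | inj₁ v≤u = ≤-trans v≤u u≤
    ... | inj₂ (gap g′ r refl refl) = subst (_≤ toℕ g * 2) (sym (pos-rightV g′ r))
          (≤-trans (n≤1+n _) (≤⇒suc*2≤ (*-cancelʳ-≤ (toℕ g′) (toℕ g) 2
            (subst (_≤ toℕ g * 2) (pos-leftV g′ r) u≤)) g′≢g))
      where
      g′≢g : toℕ g′ ≢ toℕ g
      g′≢g eq with refl ← toℕ-injective eq = case trans (sym present) (absent r) of λ ()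
    ... | inj₂ (rung i r) = *-monoˡ-≤ 2 (*-cancelʳ-< 2 (toℕ i) (toℕ g) u≤)

    -- A gap starting at `2 g ≤ 2 i + 1` has `g ≤ i`, so it ends inside; only the rail edges within
    -- block `i` would leave.
    rung-closed : ∀ i → (∀ r → edge (P i r) (Q i r) ≡ false) → Step (λ v → pos v ≤ 1 + toℕ i * 2)
    rung-closed i absent {u} u≤ v∈ present with nbr-pos u v∈
    ... | inj₁ v≤u = ≤-trans v≤u u≤
    ... | inj₂ (gap g r refl refl) = subst (_≤ 1 + toℕ i * 2) (sym (pos-rightV g r))
          (s≤s (*-monoˡ-≤ 2 (*2<suc*2⇒≤ {toℕ g} {toℕ i}
            (s≤s (subst (_≤ 1 + toℕ i * 2) (pos-leftV g r) u≤)))))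
    ... | inj₂ (rung i′ r) = ≤-trans (≤⇒suc*2≤ (*-cancelʳ-≤ (toℕ i′) (toℕ i) 2 (s≤s⁻¹ u≤)) i′≢i) (n≤1+n _)
      where
      i′≢i : toℕ i′ ≢ toℕ i
      i′≢i eq with refl ← toℕ-injective eq = case trans (sym present) (absent r) of λ ()

    -- An inner diamond shares its position with the `Q`s of its block, so no bound on `pos`
    -- separates it from them.
    data InDiamond (d : Fin (2 + j)) : Vertex → Set where
      in-A : ∀ r → InDiamond d (A d r)
      in-M : ∀ r → InDiamond d (M d r)

    diamond-closed : ∀ d → (∀ r → edge (A d r) (port d r) ≡ false) → Step (InDiamond d)
    diamond-closed d absent (in-A r) (here refl)                 _       = in-M _
    diamond-closed d absent (in-A r) (there (here refl))         present = case trans (sym present) (absent r) of λ ()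
    diamond-closed d absent (in-A r) (there (there (here refl))) _       = in-M _
    diamond-closed d absent (in-M r) (here refl)                 _       = in-A _
    diamond-closed d absent (in-M r) (there (here refl))         _       = in-A _
    diamond-closed d absent (in-M r) (there (there (here refl))) _       = in-M _

    Pair : ℕ → Set
    Pair = ClosedPair F (pos ∘ from) (_* 2)

    closedPair : ∀ {C} → Step C → ∀ {k} → (∀ {v} → C v → pos v ≤ suc k * 2) →
      ∀ {u v} → C u → C v → u ≢ v → k * 2 < pos u → k * 2 < pos v → Pair k
    closedPair step bound {u} {v} cu cv u≢v u> v> = record
      { u≢v     = u≢v ∘ to-injective
      ; u-above = subst (λ u → _ < pos u) (sym (strictlyInverseʳ u)) u>
      ; v-above = subst (λ v → _ < pos v) (sym (strictlyInverseʳ v)) v>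
      ; u-below = bound ∘ reachable-closed step cu
      ; v-below = bound ∘ reachable-closed step cv
      }

    both : ∀ {f : Fin 2 → Bool} {b} → f 0F ≡ f 1F → f 0F ≡ b → ∀ r → f r ≡ b
    both _  eq₀ 0F = eq₀
    both eq eq₀ 1F = trans (sym eq) eq₀

    -- `even-Q` excludes that all three edges at `Q i 0F` are present. An absent edge and, by
    -- balance, its partner on rail 1 decide the pair: the `P`s, the `A`s of the diamond, or the
    -- `Q`s.
    block : ∀ i → Pair (toℕ i)
    block i with edge (P i 0F) (Q i 0F) in y | edge (A (mid i) 0F) (Q i 0F) in d
               | gap-edge (suc i) 0F in x | even-Q i 0F
    ... | false | _     | _     | _ =
      closedPair (rung-closed i (both (rung-balanced i (gap-balanced (inject₁ i))) y))
        m≤n⇒m≤1+n {P i 0F} {P i 1F} ≤-refl ≤-refl (λ ()) ≤-refl ≤-refl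
    ... | true  | false | true  | _ =
      closedPair (diamond-closed (mid i) (both (diamond-balanced (mid i)) d))
        (λ { (in-A _) → ≤-refl ; (in-M _) → ≤-refl }) (in-A 0F) (in-A 1F) (λ ()) (n≤1+n _) (n≤1+n _)
    ... | true  | true  | false | _ =
      closedPair (gap-closed (suc i) (both (gap-balanced (suc i)) x))
        (λ v≤ → v≤) {Q i 0F} {Q i 1F} ≤-refl ≤-refl (λ ()) (n≤1+n _) (n≤1+n _)

    pos≤ : ∀ v → pos v ≤ suc (j * 2)
    pos≤ (inj₁ left    , _) = z≤n
    pos≤ (inj₁ right   , _) = ≤-refl
    pos≤ (inj₁ (mid i) , _) = ≤-trans (*-monoˡ-≤ 2 (toℕ<n i)) (n≤1+n _)
    pos≤ (P i r)            = ≤-trans (n≤1+n _) (≤-trans (*-monoˡ-≤ 2 (toℕ<n i)) (n≤1+n _))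
    pos≤ (Q i r)            = ≤-trans (*-monoˡ-≤ 2 (toℕ<n i)) (n≤1+n _)

    -- The whole vertex set serves as the closed set, as no position exceeds `2 j + 1`; the pair is
    -- taken from the right diamond.
    end : Pair j
    end = closedPair {C = λ v → pos v ≤ suc (j * 2)} (λ {_} {v} _ _ _ → pos≤ v) m≤n⇒m≤1+n
      {A right 0F} {A right 1F} ≤-refl ≤-refl (λ ()) ≤-refl ≤-refl

    lower : 2 * suc j ≤ exc F
    lower = exc-lower F (pos ∘ from) (_* 2) (suc j) λ i i<1+j → case m<1+n⇒m<n∨m≡n i<1+j of λ where
      (inj₁ i<j)  → subst Pair (toℕ-fromℕ< i<j) (block (fromℕ< i<j))
      (inj₂ refl) → end

  minExc : MinExc G (2 * suc j)
  -- The lower bound applied to the 2-factor itself gives equality.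
  minExc = (TwoFactor , TwoFactor⊆G , eulerian , ≤-antisym exc-TwoFactor (Lower.lower TwoFactor TwoFactor⊆G eulerian))
         , Lower.lower

  -- An st-numbering of the ladder

  -- The st-order runs outward on rail 0, passing each inner diamond right after Q i 0, through the right
  -- diamond, homeward on rail 1, and ends in the left diamond.  The factor 5 leaves room for the inner
  -- diamonds.
  span : ℕ
  span = suc (j * 2)

  -- `p` is a position. The offset `4 + span * 5` lifts rail 1 above rail 0, the inner diamonds and
  -- the `M`s of the right diamond.
  railRank : ℕ → Fin 2 → ℕ
  railRank p 0F = p * 5
  railRank p 1F = 4 + span * 5 + (span ∸ p)

  rank : Vertex → ℕ
  rank (A left r)     = railRank 0 r
  rank (M left r)     = suc (toℕ r) + railRank 0 1F
  rank (A right r)    = railRank span r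
  rank (M right r)    = suc (toℕ r) + span * 5
  rank (A (mid i) 0F) = 1 + (2 + toℕ i * 2) * 5
  rank (M (mid i) r)  = 2 + toℕ r + (2 + toℕ i * 2) * 5
  rank (A (mid i) 1F) = 4 + (2 + toℕ i * 2) * 5
  rank (P i r)        = railRank (1 + toℕ i * 2) r
  rank (Q i r)        = railRank (2 + toℕ i * 2) r

  rank-leftV : ∀ g r → rank (leftV g r) ≡ railRank (toℕ g * 2) r
  rank-leftV zero    r = refl
  rank-leftV (suc i) r = refl

  rank-rightV : ∀ g r → rank (rightV g r) ≡ railRank (suc (toℕ g * 2)) r
  rank-rightV g r with view g
  ... | ‵fromℕ     = cong (λ k → railRank (suc (k * 2)) r) (sym (toℕ-fromℕ j))
  ... | ‵inject₁ i = cong (λ k → railRank (suc (k * 2)) r) (sym (toℕ-inject₁ i))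

  outward : ∀ p → railRank p 0F < railRank (suc p) 0F
  outward p = *-monoˡ-< 5 (n<1+n p)

  -- The bound by `span` keeps the truncated subtraction strictly decreasing in `p`.
  homeward : ∀ {p} → suc p ≤ span → railRank (suc p) 1F < railRank p 1F
  homeward {p} p<span = +-monoʳ-< (4 + span * 5) (∸-monoʳ-< (n<1+n p) p<span)

  gap-outward : ∀ g → rank (leftV g 0F) < rank (rightV g 0F)
  gap-outward g = subst₂ _<_ (sym (rank-leftV g 0F)) (sym (rank-rightV g 0F)) (outward (toℕ g * 2))

  gap-homeward : ∀ g → rank (rightV g 1F) < rank (leftV g 1F)
  gap-homeward g = subst₂ _<_ (sym (rank-rightV g 1F)) (sym (rank-leftV g 1F))
    (homeward (s≤s (*-monoˡ-≤ 2 (s≤s⁻¹ (toℕ<n g)))))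

  P-outward : ∀ i → rank (leftV (inject₁ i) 0F) < rank (P i 0F)
  P-outward i = subst (λ v → rank (leftV (inject₁ i) 0F) < rank v) (rightV-inject₁ i 0F) (gap-outward (inject₁ i))

  P-homeward : ∀ i → rank (P i 1F) < rank (leftV (inject₁ i) 1F)
  P-homeward i = subst (λ v → rank v < rank (leftV (inject₁ i) 1F)) (rightV-inject₁ i 1F) (gap-homeward (inject₁ i))

  right-outward : rank (leftV (fromℕ j) 0F) < rank (A right 0F)
  right-outward = subst (λ v → rank (leftV (fromℕ j) 0F) < rank v) (rightV-fromℕ 0F) (gap-outward (fromℕ j))

  right-homeward : rank (A right 1F) < rank (leftV (fromℕ j) 1F)
  right-homeward = subst (λ v → rank v < rank (leftV (fromℕ j) 1F)) (rightV-fromℕ 1F) (gap-homeward (fromℕ j))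

  2+i*2<span : ∀ (i : Fin j) → 2 + toℕ i * 2 < span
  2+i*2<span i = s≤s (*-monoˡ-≤ 2 (toℕ<n i))

  -- An inner diamond is an ear from `Q i 0F` to `Q i 1F`. Its last rank is below `5 (2 i + 3)`,
  -- which is at most `span * 5` and hence below rail 1.
  mid-turn : ∀ i → rank (A (mid i) 1F) < rank (Q i 1F)
  mid-turn i = ≤-trans (*-monoˡ-≤ 5 (2+i*2<span i)) (≤-trans (m≤n+m (span * 5) 4) (m≤m+n (4 + span * 5) _))

  right-turn : rank (M right 1F) < rank (A right 1F)
  right-turn = s≤s (s≤s (s≤s (≤-trans (m≤m+n (span * 5) _) (n≤1+n _))))

  down : ∀ v → v ≡ A left 0F ⊎ ∃[ w ] w ∈ˡ nbrs v × rank w < rank v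
  down (A left 0F)    = inj₁ refl
  down (A left 1F)    = inj₂ (_ , there (here refl) , gap-homeward zero)
  down (A right 0F)   = inj₂ (_ , there (here refl) , right-outward)
  down (A right 1F)   = inj₂ (_ , there (there (here refl)) , right-turn)
  down (A (mid i) 0F) = inj₂ (_ , there (here refl) , ≤-refl)
  down (A (mid i) 1F) = inj₂ (_ , there (there (here refl)) , ≤-refl)
  down (M left 0F)    = inj₂ (A left 1F , here refl , ≤-refl)
  down (M left 1F)    = inj₂ (_ , there (there (here refl)) , ≤-refl)
  down (M right 0F)   = inj₂ (_ , there (here refl) , ≤-refl)
  down (M right 1F)   = inj₂ (_ , there (there (here refl)) , ≤-refl)
  down (M (mid i) 0F) = inj₂ (_ , there (here refl) , ≤-refl)
  down (M (mid i) 1F) = inj₂ (_ , there (there (here refl)) , ≤-refl)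
  down (P i 0F)       = inj₂ (_ , there (here refl) , P-outward i)
  down (P i 1F)       = inj₂ (_ , here refl , homeward (<⇒≤ (2+i*2<span i)))
  down (Q i 0F)       = inj₂ (_ , here refl , outward (1 + toℕ i * 2))
  down (Q i 1F)       = inj₂ (_ , there (here refl) , mid-turn i)

  up : ∀ v → v ≡ M left 1F ⊎ ∃[ w ] w ∈ˡ nbrs v × rank v < rank w
  up (A left 0F)    = inj₂ (_ , there (here refl) , gap-outward zero)
  up (A left 1F)    = inj₂ (M left 0F , here refl , ≤-refl)
  up (A right 0F)   = inj₂ (_ , there (there (here refl)) , ≤-refl)
  up (A right 1F)   = inj₂ (_ , there (here refl) , right-homeward)
  up (A (mid i) 0F) = inj₂ (_ , there (there (here refl)) , ≤-refl)
  up (A (mid i) 1F) = inj₂ (_ , there (here refl) , mid-turn i)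
  up (M left 0F)    = inj₂ (_ , there (there (here refl)) , ≤-refl)
  up (M left 1F)    = inj₁ refl
  up (M right 0F)   = inj₂ (_ , there (there (here refl)) , ≤-refl)
  up (M right 1F)   = inj₂ (_ , there (here refl) , right-turn)
  up (M (mid i) 0F) = inj₂ (_ , there (there (here refl)) , ≤-refl)
  up (M (mid i) 1F) = inj₂ (_ , there (here refl) , ≤-refl)
  up (P i 0F)       = inj₂ (_ , here refl , outward (1 + toℕ i * 2))
  up (P i 1F)       = inj₂ (_ , there (here refl) , P-homeward i)
  up (Q i 0F)       = inj₂ (_ , there (here refl) , ≤-refl)
  up (Q i 1F)       = inj₂ (_ , here refl , homeward (<⇒≤ (2+i*2<span i)))

  twoConnected : TwoConnected G
  twoConnected = s≤s (s≤s (s≤s z≤n)) , st-connected G (rank ∘ from) bottom∼top down′ up′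
               , st-connectedWithout G (rank ∘ from) bottom∼top down′ up′
    where
    rank-to : ∀ v → rank v ≡ rank (from (to v))
    rank-to v = cong rank (sym (strictlyInverseʳ v))
    bottom∼top : Adj G (to (A left 0F)) (to (M left 1F))
    -- The numbering starts and ends in the left diamond, at the two ends of one of its chords.
    bottom∼top = GN.adj-to⁺ (here refl)
    down′ : ∀ x → x ≡ to (A left 0F) ⊎ ∃[ y ] Adj G x y × rank (from y) < rank (from x)
    down′ = ∀-code λ v → case down v of λ where
      (inj₁ refl)           → inj₁ refl
      (inj₂ (w , w∈ , w<v)) → inj₂ (to w , GN.adj-to⁺ w∈ , subst₂ _<_ (rank-to w) (rank-to v) w<v)
    up′ : ∀ x → x ≡ to (M left 1F) ⊎ ∃[ y ] Adj G x y × rank (from x) < rank (from y)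
    up′ = ∀-code λ v → case up v of λ where
      (inj₁ refl)           → inj₁ refl
      (inj₂ (w , w∈ , v<w)) → inj₂ (to w , GN.adj-to⁺ w∈ , subst₂ _<_ (rank-to v) (rank-to w) v<w)

-- Orders divisible by 8

proposition31 : (n : ℕ) → 8 ≤ n → 8 ∣ n →
    Σ[ G ∈ Graph n ] (TwoConnected G × Cubic G × MinExc G (n / 4))
proposition31 .(0 * 8)     () (divides zero    refl)
proposition31 .(suc j * 8) _  (divides (suc j) refl) =
  subst (λ n → Σ[ G ∈ Graph n ] (TwoConnected G × Cubic G × MinExc G (n / 4))) size≡
    (G , twoConnected , cubic , subst (MinExc G) size/4 minExc)
  where
  open Ladder j
  open ≡-Reasoning
  sites≡ : 2 + j + j ≡ 2 * suc j
  sites≡ = cong suc (trans (sym (+-suc j j)) (cong (λ k → j + suc k) (sym (+-identityʳ j))))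
  size≡ : size ≡ suc j * 8
  size≡ = begin
    (2 + j + j) * 4 ≡⟨ cong (_* 4) (trans sites≡ (*-comm 2 (suc j))) ⟩
    suc j * 2 * 4   ≡⟨ *-assoc (suc j) 2 4 ⟩
    suc j * 8       ∎
  size/4 : 2 * suc j ≡ size / 4
  size/4 = trans (sym sites≡) (sym (m*n/n≡m (2 + j + j) 4))
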